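{- Let $R,S$ be selections and let $\mathit{sk}$ be an annotated sketch. 1. If $\models\mathit{vc}(\langle R\rangle\,\mathit{sk}\,\langle S\rangle)$ then $\models_a\langle R\rangle\,\mathit{sk}\,\langle S\rangle$. 2. If all annotations are sound and complete, then $\models_a\langle R\rangle\,\mathit{sk}\,\langle S\rangle$ implies $\models\mathit{vc}(\langle R\rangle\,\mathit{sk}\,\langle S\rangle)$.
   Context: **Parameters and predicates.** Fix a set $\mathrm{States}$, a set $\mathrm{COM}$ of commands, and functions $[\![c]\!]:\mathrm{States}\to\mathrm{Predicates}$, where $\mathrm{Predicates}=\mathcal P(\mathrm{States})\cup\{\mathit{fail}\}$. $r\preceq_d s$ iff $s=\mathit{fail}$, or ($r\neq\mathit{fail}$ and $r\subseteq s$). The join $\sqcup_d$ of a set of predicates is $\mathit{fail}$ if $\mathit{fail}$ is a member, otherwise the union. Lift: $[\![c]\!](\mathit{fail})=\mathit{fail}$ and $[\![c]\!](r)=\bigsqcup_d\{[\![c]\!](q)\mid q\in r\}$ for $r\ne\mathit{fail}$. **Programs, sketches, validity.** Programs: $p::=c\mid p;p\mid p+p\mid p^*$. $\mathit{exec}(p)$ is the language of $p$ as a regular expression over $\mathrm{COM}$; $[\![e_1;e_2]\!](r)=[\![e_2]\!]([\![e_1]\!](r))$, the empty sequence is the identity. $\models_d\{r\}p\{s\}$ iff $[\![e]\!](r)\preceq_d s$ for all $e\in\mathit{exec}(p)$. Sketches additionally allow non-terminals $N$ from a finite set, each with a nonempty set of sketches as productions; $\mathit{drv}(\mathit{sk})$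 is the set of programs derivable from $\mathit{sk}$ by repeatedly replacing occurrences of non-terminals by productions (different occurrences may be replaced differently; $\mathit{sk}^*$ derives the $p^*$ with $p\in\mathit{drv}(\mathit{sk})$). A selection is a finite set of predicates. $R\preceq_a S$ iff $\forall s\in S\,\exists r\in R.\ r\preceq_d s$. $\models_a\langle R\rangle\mathit{sk}\langle S\rangle$ iff $\forall s\in S\,\exists r\in R\,\exists p\in\mathit{drv}(\mathit{sk}).\ \models_d\{r\}p\{s\}$. **Annotations.** In an annotated sketch every loop carries a selection $I$ (invariant), written $\mathit{sk}^*[I]$, and every non-terminal carries a map $\Gamma$ from selections to selections, written $N[\Gamma]$. Annotations are ignored in $\models_a$ and $\mathit{drv}$. $I$ at $\mathit{sk}^*[I]$ is *sound* if $\models_a\langle\{i\}\rangle\mathit{sk}\langle\{i\}\rangle$ for all $i\in I$, and *complete* if $\models_a\langle\{j\}\rangle\mathit{sk}\langle\{j\}\rangle$ implies $j\in I$. $\Gamma$ at $N[\Gamma]$ is *sound* if $\models_a\langle R\rangle N\langle\Gamma(R)\rangle$ for all $R$, and *complete* if $\models_a\langle R\rangle N\langle S\rangle$ implies $\Gamma(R)\preceq_a S$. A fixed oracle enumerates, for each $N$, the programs in $\mathit{drv}(N)$; $\mathbb O(N,j)$ is the set of the first $j$ programs it returns, and every program of $\mathit{drv}(N)$ is eventually returned. Loops of returned programs are annotated by invariants as well; "all annotations" includes these. **Strongest post.** - $\mathit{sp}(R,c)=\{[\![c]\!](r)\mid r\in R\}$; $\mathit{sp}(R,N[\Gamma])=\Gamma(R)$;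 - $\mathit{sp}(R,\mathit{sk}_1;\mathit{sk}_2)=\mathit{sp}(\mathit{sp}(R,\mathit{sk}_1),\mathit{sk}_2)$; $\mathit{sp}(R,\mathit{sk}^*[I])=\{i\in I\mid R\preceq_a\{i\}\}$; - $\mathit{sp}(R,\mathit{sk}_1+\mathit{sk}_2)=\{s_1\sqcup_d s_2\mid r\in R,\ s_1\in\mathit{sp}(\{r\},\mathit{sk}_1),\ s_2\in\mathit{sp}(\{r\},\mathit{sk}_2)\}$. **Verification conditions.** $\mathit{vc}$ yields a set of inequalities between selections: - $\mathit{vc}(\langle R\rangle c\langle S\rangle)=\{\mathit{sp}(R,c)\preceq_a S\}$; - $\mathit{vc}(\langle R\rangle\mathit{sk}_1;\mathit{sk}_2\langle S\rangle)=\mathit{vc}(\langle R\rangle\mathit{sk}_1\langle\mathit{sp}(R,\mathit{sk}_1)\rangle)\cup\mathit{vc}(\langle\mathit{sp}(R,\mathit{sk}_1)\rangle\mathit{sk}_2\langle S\rangle)$; - $\mathit{vc}(\langle R\rangle\mathit{sk}_1+\mathit{sk}_2\langle S\rangle)=\{\mathit{sp}(R,\mathit{sk}_1+\mathit{sk}_2)\preceq_a S\}\cup\bigcup_{r\in R,\,k\in\{1,2\}}\mathit{vc}(\langle\{r\}\rangle\mathit{sk}_k\langle\mathit{sp}(\{r\},\mathit{sk}_k)\rangle)$; - $\mathit{vc}(\langle R\rangle\mathit{sk}^*[I]\langle S\rangle)=\{\mathit{sp}(R,\mathit{sk}^*[I])\preceq_a S\}\cup\bigcup_{i\in I}\mathit{vc}(\langle\{i\}\rangle\mathit{sk}\langle\{i\}\rangle)$;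 - $\mathit{vc}(\langle R\rangle N[\Gamma]\langle S\rangle)=\{\mathit{sp}(R,N[\Gamma])\preceq_a S\}\cup\bigcup_{p\in\mathbb O(N,j)}\mathit{vc}(\langle R\rangle p\langle\mathit{sp}(R,p)\rangle)$, where $j$ is the least number with $\bigcup_{p'\in\mathbb O(N,j)}\mathit{sp}(R,p')\preceq_a\Gamma(R)$. If there is no such $j$, $\mathit{vc}$ is undefined (its computation does not terminate). $\models\mathit{vc}(\dots)$ means that $\mathit{vc}(\dots)$ is defined and all its inequalities hold. -}

module Defs where

open import Axiom.ExcludedMiddle using (ExcludedMiddle)
open import Data.Bool.Base using (Bool; if_then_else_)
open import Data.Empty using (⊥)
open import Data.Fin.Base using (Fin)
open import Data.List.Base
  using (List; []; _∷_; [_]; _++_; map; concat; concatMap; cartesianProductWith; filter; foldr; mapMaybe; upTo)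
import Data.List.Membership.Setoid as Membership
import Data.List.Relation.Binary.Subset.Setoid as Subset
open import Data.List.Relation.Unary.All using (All)
open import Data.List.Relation.Unary.Any using (Any)
open import Data.Maybe.Base as Maybe using (Maybe; just; nothing)
open import Data.Nat.Base using (ℕ; suc; _<_)
open import Data.Product.Base using (_×_; _,_; proj₁; ∃; ∃-syntax)
open import Data.Unit.Base using (⊤; tt)
open import Level using (0ℓ) renaming (suc to lsuc)
open import Relation.Binary.Bundles using (Setoid)
open import Relation.Binary.Construct.Closure.ReflexiveTransitive using (Star)
open import Relation.Binary.PropositionalEquality.Core using (_≡_)
open import Relation.Nullary.Decidable.Core using (yes; no)
open import Relation.Nullary.Negation.Core using (¬_)
open import Relation.Unary using (Pred; Satisfiable; _∪_; _⊆_)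

data Predicate (States : Set) : Set₁ where
  fail : Predicate States
  ⟪_⟫  : Pred States 0ℓ → Predicate States

-- Sketches with non-terminals drawn from NT; a program is a sketch over the
-- empty set of non-terminals.
data Sketch (COM NT : Set) : Set where
  cmd : COM → Sketch COM NT
  _⨾_ : Sketch COM NT → Sketch COM NT → Sketch COM NT
  _+_ : Sketch COM NT → Sketch COM NT → Sketch COM NT
  _⋆  : Sketch COM NT → Sketch COM NT
  nt  : NT → Sketch COM NT

Program : Set → Set
Program COM = Sketch COM ⊥

embed : ∀ {COM NT} → Program COM → Sketch COM NT
embed (cmd c) = cmd c
embed (p ⨾ q) = embed p ⨾ embed q
embed (p + q) = embed p + embed q
embed (p ⋆)   = embed p ⋆

record Grammar (COM : Set) : Set₁ where
  field
    #NT : ℕ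

  NonTerminal : Set
  NonTerminal = Fin #NT

  field
    productions : NonTerminal → Pred (Sketch COM NonTerminal) 0ℓ
    nonempty    : ∀ N → Satisfiable (productions N)

-- The development is classical: excluded middle decides which case of the
-- join applies, membership in set comprehensions, and definedness of vc.
module Framework
  (em : ExcludedMiddle (lsuc 0ℓ))
  {States COM : Set}
  (⟦_⟧ : COM → States → Predicate States)
  (G : Grammar COM)
  where

  open Grammar G

  infix 4 _⪯_ _≃_ _⪯ₐ_ _≈ₛ_

  _⪯_ : Predicate States → Predicate States → Set
  _     ⪯ fail  = ⊤
  fail  ⪯ ⟪ _ ⟫ = ⊥
  ⟪ r ⟫ ⪯ ⟪ s ⟫ = r ⊆ s

  -- Equality of predicates; subsets of States are compared extensionally.
  _≃_ : Predicate States → Predicate States → Set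
  r ≃ s = r ⪯ s × s ⪯ r

  ⪯-refl : ∀ r → r ⪯ r
  ⪯-refl fail  = tt
  ⪯-refl ⟪ _ ⟫ = λ σ∈r → σ∈r

  ⪯-trans : ∀ r s t → r ⪯ s → s ⪯ t → r ⪯ t
  ⪯-trans r     s     fail  _   _   = tt
  ⪯-trans ⟪ _ ⟫ ⟪ _ ⟫ ⟪ _ ⟫ r⊆s s⊆t = λ σ∈r → s⊆t (r⊆s σ∈r)

  predicateSetoid : Setoid (lsuc 0ℓ) 0ℓ
  predicateSetoid = record
    { Carrier       = Predicate States
    ; _≈_           = _≃_
    ; isEquivalence = record
      { refl  = λ {r} → ⪯-refl r , ⪯-refl r
      ; sym   = λ (r⪯s , s⪯r) → s⪯r , r⪯s
      ; trans = λ {r} {s} {t} (r⪯s , s⪯r) (s⪯t , t⪯s) →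
          ⪯-trans r s t r⪯s s⪯t , ⪯-trans t s r t⪯s s⪯r
      }
    }

  _∋_ : Predicate States → Pred States 0ℓ
  fail  ∋ σ = ⊥
  ⟪ r ⟫ ∋ σ = r σ

  -- The join of the set { f i ∣ i : Ix }.
  ⨆ : {Ix : Set} → (Ix → Predicate States) → Predicate States
  ⨆ f with em {∃[ i ] f i ≡ fail}
  ... | yes _ = fail
  ... | no  _ = ⟪ (λ σ → ∃[ i ] f i ∋ σ) ⟫

  _⊔_ : Predicate States → Predicate States → Predicate States
  r ⊔ s = ⨆ λ (b : Bool) → if b then r else s

  ⟦_⟧↑ : COM → Predicate States → Predicate States
  ⟦ c ⟧↑ fail  = fail
  ⟦ c ⟧↑ ⟪ r ⟫ = ⨆ λ (q : ∃ r) → ⟦ c ⟧ (proj₁ q)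

  ⟦_⟧* : List COM → Predicate States → Predicate States
  ⟦ [] ⟧*    r = r
  ⟦ c ∷ e ⟧* r = ⟦ e ⟧* (⟦ c ⟧↑ r)

  exec : Program COM → Pred (List COM) 0ℓ
  exec (cmd c) e = e ≡ [ c ]
  exec (p ⨾ q) e = ∃[ e₁ ] ∃[ e₂ ] exec p e₁ × exec q e₂ × e ≡ e₁ ++ e₂
  exec (p + q)   = exec p ∪ exec q
  exec (p ⋆)   e = ∃[ es ] All (exec p) es × e ≡ concat es

  ⊨d⟨_⟩_⟨_⟩ : Predicate States → Program COM → Predicate States → Set
  ⊨d⟨ r ⟩ p ⟨ s ⟩ = ∀ e → exec p e → ⟦ e ⟧* r ⪯ s

  data _⇒_ : Sketch COM NonTerminal → Sketch COM NonTerminal → Set where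
    expand : ∀ {N π} → productions N π → nt N ⇒ π
    ⨾ˡ     : ∀ {a a′ b} → a ⇒ a′ → (a ⨾ b) ⇒ (a′ ⨾ b)
    ⨾ʳ     : ∀ {a b b′} → b ⇒ b′ → (a ⨾ b) ⇒ (a ⨾ b′)
    +ˡ     : ∀ {a a′ b} → a ⇒ a′ → (a + b) ⇒ (a′ + b)
    +ʳ     : ∀ {a b b′} → b ⇒ b′ → (a + b) ⇒ (a + b′)
    ⋆-cong : ∀ {a a′} → a ⇒ a′ → (a ⋆) ⇒ (a′ ⋆)

  drv : Sketch COM NonTerminal → Pred (Program COM) 0ℓ
  drv sk p = Star _⇒_ sk (embed p)

  -- Finite sets of predicates, as lists taken up to _≈ₛ_.
  Selection : Set₁
  Selection = List (Predicate States)

  open Membership predicateSetoid public using (_∈_)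

  _≈ₛ_ : Selection → Selection → Set₁
  R ≈ₛ S = Subset._⊆_ predicateSetoid R S × Subset._⊆_ predicateSetoid S R

  _⪯ₐ_ : Selection → Selection → Set₁
  R ⪯ₐ S = All (λ s → Any (λ r → r ⪯ s) R) S

  ⊨ₐ⟨_⟩_⟨_⟩ : Selection → Sketch COM NonTerminal → Selection → Set₁
  ⊨ₐ⟨ R ⟩ sk ⟨ S ⟩ = All (λ s → Any (λ r → ∃[ p ] drv sk p × ⊨d⟨ r ⟩ p ⟨ s ⟩) R) S

  record Transformer : Set₁ where
    field
      apply : Selection → Selection
      cong  : ∀ {R S} → R ≈ₛ S → apply R ≈ₛ apply S

  open Transformer public

  data AnnSketch (NT : Set) : Set₁ where
    cmd   : COM → AnnSketch NT
    _⨾_   : AnnSketch NT → AnnSketch NT → AnnSketch NT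
    _+_   : AnnSketch NT → AnnSketch NT → AnnSketch NT
    _⋆[_] : AnnSketch NT → Selection → AnnSketch NT
    nt    : NT → Transformer → AnnSketch NT

  AnnProgram : Set₁
  AnnProgram = AnnSketch ⊥

  erase : ∀ {NT} → AnnSketch NT → Sketch COM NT
  erase (cmd c)     = cmd c
  erase (a ⨾ b)     = erase a ⨾ erase b
  erase (a + b)     = erase a + erase b
  erase (a ⋆[ I ])  = erase a ⋆
  erase (nt N Γ)    = nt N

  embedₐ : ∀ {NT} → AnnProgram → AnnSketch NT
  embedₐ (cmd c)    = cmd c
  embedₐ (p ⨾ q)    = embedₐ p ⨾ embedₐ q
  embedₐ (p + q)    = embedₐ p + embedₐ q
  embedₐ (p ⋆[ I ]) = embedₐ p ⋆[ I ]

  -- The enumeration of drv (nt N) may be finite or even empty: nothing means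
  -- that it is exhausted.
  record Oracle : Set₁ where
    field
      enum      : NonTerminal → ℕ → Maybe AnnProgram
      exhausted : ∀ N j → enum N j ≡ nothing → enum N (suc j) ≡ nothing
      derivable : ∀ N j p → enum N j ≡ just p → drv (nt N) (erase p)
      returned  : ∀ N p → drv (nt N) p → ∃[ j ] ∃[ p′ ] enum N j ≡ just p′ × erase p′ ≡ p

    first : NonTerminal → ℕ → List AnnProgram
    first N j = mapMaybe (enum N) (upTo j)

  sp : ∀ {NT} → Selection → AnnSketch NT → Selection
  sp R (cmd c)    = map ⟦ c ⟧↑ R
  sp R (a ⨾ b)    = sp (sp R a) b
  sp R (a + b)    = concatMap (λ r → cartesianProductWith _⊔_ (sp [ r ] a) (sp [ r ] b)) R
  sp R (a ⋆[ I ]) = filter {P = λ i → R ⪯ₐ [ i ]} (λ _ → em) I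
  sp R (nt N Γ)   = apply Γ R

  SoundInv CompleteInv : Selection → Sketch COM NonTerminal → Set₁
  SoundInv    I sk = All (λ i → ⊨ₐ⟨ [ i ] ⟩ sk ⟨ [ i ] ⟩) I
  CompleteInv I sk = ∀ j → ⊨ₐ⟨ [ j ] ⟩ sk ⟨ [ j ] ⟩ → j ∈ I

  SoundTrans CompleteTrans : Transformer → NonTerminal → Set₁
  SoundTrans    Γ N = ∀ R → ⊨ₐ⟨ R ⟩ nt N ⟨ apply Γ R ⟩
  CompleteTrans Γ N = ∀ R S → ⊨ₐ⟨ R ⟩ nt N ⟨ S ⟩ → apply Γ R ⪯ₐ S

  Inequality : Set₁
  Inequality = Selection × Selection

  -- A set of inequalities, or nothing when undefined.
  VC : Set₁
  VC = Maybe (List Inequality)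

  ineq : Selection → Selection → VC
  ineq R S = just [ (R , S) ]

  -- A union is defined only if all its constituents are.
  _∪ᵥ_ : VC → VC → VC
  _∪ᵥ_ = Maybe.zipWith _++_

  ⋃ : List VC → VC
  ⋃ = foldr _∪ᵥ_ (just [])

  data ⊨_ : VC → Set₁ where
    holds : ∀ {Q} → All (λ (R , S) → R ⪯ₐ S) Q → ⊨ (just Q)

  -- The argument h supplies the part of the conditions at a non-terminal that
  -- comes from the oracle.
  vcWith : ∀ {NT} → (Selection → NT → Transformer → VC) →
           Selection → AnnSketch NT → Selection → VC
  vcWith h R sk@(cmd c)    S = ineq (sp R sk) S
  vcWith h R (a ⨾ b)       S = vcWith h R a (sp R a) ∪ᵥ vcWith h (sp R a) b S
  vcWith h R sk@(a + b)    S = ineq (sp R sk) S ∪ᵥ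
    ⋃ (map (λ r → vcWith h [ r ] a (sp [ r ] a) ∪ᵥ vcWith h [ r ] b (sp [ r ] b)) R)
  vcWith h R sk@(a ⋆[ I ]) S = ineq (sp R sk) S ∪ᵥ
    ⋃ (map (λ i → vcWith h [ i ] a [ i ]) I)
  vcWith h R sk@(nt N Γ)   S = ineq (sp R sk) S ∪ᵥ h R N Γ

  vcProgram : Selection → AnnProgram → Selection → VC
  vcProgram = vcWith (λ _ ())

  Least : (ℕ → Set₁) → ℕ → Set₁
  Least P j = P j × (∀ k → k < j → ¬ P k)

  module _ (𝕆 : Oracle) where

    open Oracle 𝕆

    Covers : Selection → NonTerminal → Transformer → ℕ → Set₁
    Covers R N Γ j = concatMap (sp R) (first N j) ⪯ₐ apply Γ R

    vcOracle : Selection → NonTerminal → Transformer → VC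
    vcOracle R N Γ with em {∃ (Least (Covers R N Γ))}
    ... | yes (j , _) = ⋃ (map (λ p → vcProgram R p (sp R p)) (first N j))
    ... | no  _       = nothing

    vc : Selection → AnnSketch NonTerminal → Selection → VC
    vc = vcWith vcOracle

    -- All annotations in a sketch are sound and complete, including those of
    -- the programs returned by the oracle for its non-terminals.
    data SoundComplete : AnnSketch NonTerminal → Set₁ where
      cmd   : ∀ {c} → SoundComplete (cmd c)
      _⨾_   : ∀ {a b} → SoundComplete a → SoundComplete b → SoundComplete (a ⨾ b)
      _+_   : ∀ {a b} → SoundComplete a → SoundComplete b → SoundComplete (a + b)
      _⋆[_] : ∀ {a I} → SoundComplete a → SoundInv I (erase a) × CompleteInv I (erase a) →
              SoundComplete (a ⋆[ I ])
      nt    : ∀ {N Γ} → SoundTrans Γ N × CompleteTrans Γ N →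
              (∀ j p → enum N j ≡ just p → SoundComplete (embedₐ p)) →
              SoundComplete (nt N Γ)

{-# OPTIONS --safe #-}

-- The lifted ⟦ c ⟧ preserve joins, so whenever {r} p;q {s} holds, the join t of the
-- outcomes of p on r is an intermediate assertion with {r} p {t} and {t} q {s}; likewise the join
-- of the outcomes of p* on r is an invariant of p. With complete annotations this makes sp(R, sk)
-- the ⪯ₐ-least postcondition of R. At a non-terminal, each of the finitely many elements of Γ(R) is
-- witnessed by one program, so finitely many oracle calls suffice and vc is defined.
module Submission where

open import Defs
open import Axiom.ExcludedMiddle using (ExcludedMiddle)
open import Data.Bool.Base using (true; false; if_then_else_)
open import Data.Empty using (⊥-elim)
open import Data.List.Base
  using (List; []; _∷_; [_]; _++_; map; concat; concatMap; cartesianProductWith; upTo)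
open import Data.List.Membership.Propositional using (find; lose) renaming (_∈_ to _∈ₚ_)
open import Data.List.Membership.Propositional.Properties using (∈-filter⁺; ∈-filter⁻)
open import Data.List.Properties using (++-identityʳ; concat-++; concatMap-cong; map-cong)
open import Data.List.Relation.Unary.All as All using (All; []; _∷_)
import Data.List.Relation.Unary.All.Properties as All
open import Data.List.Relation.Unary.Any as Any using (Any; here)
import Data.List.Relation.Unary.Any.Properties as Any
open import Data.Maybe.Base using (just; nothing)
import Data.Maybe.Relation.Unary.All as Maybe
import Data.Maybe.Relation.Unary.Any as MaybeAny
open import Data.Nat.Base using (ℕ; suc; _<_; _≤_) renaming (_⊔_ to _⊔ℕ_)
open import Data.Nat.Induction using (<-rec)
open import Data.Nat.Properties using (≤-refl; ≤-trans; m≤m⊔n; m≤n⊔m)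
open import Data.Product.Base using (_×_; _,_; proj₁; ∃; ∃-syntax)
open import Data.Sum.Base using (inj₁; inj₂)
open import Data.Unit.Base using (tt)
open import Function.Base using (id; _∘_)
open import Level using (0ℓ) renaming (suc to lsuc)
open import Relation.Binary.Construct.Closure.ReflexiveTransitive using (Star; ε; _◅_; _◅◅_; gmap)
open import Relation.Binary.PropositionalEquality
  using (_≡_; refl; sym; trans; cong; cong₂; subst; setoid)
open import Relation.Nullary.Decidable.Core using (yes; no)

module _
  (em : ExcludedMiddle (lsuc 0ℓ))
  {States COM : Set}
  (⟦_⟧ : COM → States → Predicate States)
  (G : Grammar COM)
  where

  open Framework em ⟦_⟧ G hiding (cong)
  open Grammar G

  -- Joins and the lifted semantics of command sequences.

  ∋-mono : ∀ r s {σ} → r ⪯ ⟪ s ⟫ → r ∋ σ → s σ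
  ∋-mono ⟪ _ ⟫ s r⊆s σ∈r = r⊆s σ∈r

  ⨆-upper : {Ix : Set} (f : Ix → Predicate States) (i : Ix) → f i ⪯ ⨆ f
  ⨆-upper f i with em {∃[ i ] f i ≡ fail}
  ... | yes _  = tt
  ... | no  ¬fail with f i in eq
  ...   | fail  = ⊥-elim (¬fail (i , eq))
  ...   | ⟪ r ⟫ = λ σ∈r → i , subst (_∋ _) (sym eq) σ∈r

  ⨆-least : {Ix : Set} (f : Ix → Predicate States) (s : Predicate States) →
            (∀ i → f i ⪯ s) → ⨆ f ⪯ s
  ⨆-least f fail  f⪯s = tt
  ⨆-least f ⟪ s ⟫ f⪯s with em {∃[ i ] f i ≡ fail}
  ... | yes (i , eq) = subst (_⪯ ⟪ s ⟫) eq (f⪯s i)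
  ... | no  _        = λ (i , σ∈fi) → ∋-mono (f i) s (f⪯s i) σ∈fi

  ⊔-upperˡ : ∀ r s → r ⪯ r ⊔ s
  ⊔-upperˡ r s = ⨆-upper (λ b → if b then r else s) true

  ⊔-upperʳ : ∀ r s → s ⪯ r ⊔ s
  ⊔-upperʳ r s = ⨆-upper (λ b → if b then r else s) false

  ⊔-least : ∀ r s t → r ⪯ t → s ⪯ t → r ⊔ s ⪯ t
  ⊔-least r s t r⪯t s⪯t =
    ⨆-least (λ b → if b then r else s) t λ { true → r⪯t ; false → s⪯t }

  ⟦⟧⪯⟦⟧↑ : ∀ c r {σ} → r ∋ σ → ⟦ c ⟧ σ ⪯ ⟦ c ⟧↑ r
  ⟦⟧⪯⟦⟧↑ c ⟪ r ⟫ {σ} σ∈r = ⨆-upper (λ (q : ∃ r) → ⟦ c ⟧ (proj₁ q)) (σ , σ∈r)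

  ⟦⟧↑-mono : ∀ c r s → r ⪯ s → ⟦ c ⟧↑ r ⪯ ⟦ c ⟧↑ s
  ⟦⟧↑-mono c r     fail  _   = tt
  ⟦⟧↑-mono c ⟪ r ⟫ ⟪ s ⟫ r⊆s =
    ⨆-least _ (⟦ c ⟧↑ ⟪ s ⟫) λ (σ , σ∈r) → ⟦⟧⪯⟦⟧↑ c ⟪ s ⟫ (r⊆s σ∈r)

  ⟦⟧*-mono : ∀ e r s → r ⪯ s → ⟦ e ⟧* r ⪯ ⟦ e ⟧* s
  ⟦⟧*-mono []      r s r⪯s = r⪯s
  ⟦⟧*-mono (c ∷ e) r s r⪯s = ⟦⟧*-mono e (⟦ c ⟧↑ r) (⟦ c ⟧↑ s) (⟦⟧↑-mono c r s r⪯s)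

  ⟦⟧*-++ : ∀ e₁ e₂ r → ⟦ e₁ ++ e₂ ⟧* r ≡ ⟦ e₂ ⟧* (⟦ e₁ ⟧* r)
  ⟦⟧*-++ []       e₂ r = refl
  ⟦⟧*-++ (c ∷ e₁) e₂ r = ⟦⟧*-++ e₁ e₂ (⟦ c ⟧↑ r)

  -- If some `f i` is `fail`, the left side is `⟦ c ⟧↑ (f i)`, a member of the right-hand join.
  -- Otherwise every state of the union lies in some `f i`, whose image bounds that of the state.
  ⟦⟧↑-⨆ : {Ix : Set} (c : COM) (f : Ix → Predicate States) →
          ⟦ c ⟧↑ (⨆ f) ⪯ ⨆ (λ i → ⟦ c ⟧↑ (f i))
  ⟦⟧↑-⨆ c f with em {∃[ i ] f i ≡ fail}
  ... | yes (i , eq) = subst (λ r → ⟦ c ⟧↑ r ⪯ ⨆ (λ i → ⟦ c ⟧↑ (f i))) eq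
                         (⨆-upper (λ i → ⟦ c ⟧↑ (f i)) i)
  ... | no  _        = ⨆-least _ (⨆ (λ i → ⟦ c ⟧↑ (f i))) λ (σ , i , σ∈fi) →
    ⪯-trans (⟦ c ⟧ σ) (⟦ c ⟧↑ (f i)) _ (⟦⟧⪯⟦⟧↑ c (f i) σ∈fi) (⨆-upper (λ i → ⟦ c ⟧↑ (f i)) i)

  ⟦⟧*-⨆-least : {Ix : Set} (e : List COM) (f : Ix → Predicate States) (s : Predicate States) →
                (∀ i → ⟦ e ⟧* (f i) ⪯ s) → ⟦ e ⟧* (⨆ f) ⪯ s
  ⟦⟧*-⨆-least []      f s h = ⨆-least f s h
  ⟦⟧*-⨆-least (c ∷ e) f s h =
    ⪯-trans (⟦ e ⟧* (⟦ c ⟧↑ (⨆ f))) (⟦ e ⟧* (⨆ (λ i → ⟦ c ⟧↑ (f i)))) s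
      (⟦⟧*-mono e _ _ (⟦⟧↑-⨆ c f)) (⟦⟧*-⨆-least e (λ i → ⟦ c ⟧↑ (f i)) s h)

  -- Strongest postconditions and triples of single programs.

  post : Program COM → Predicate States → Predicate States
  post p r = ⨆ λ (e : ∃ (exec p)) → ⟦ proj₁ e ⟧* r

  ⊨d-post : ∀ r p → ⊨d⟨ r ⟩ p ⟨ post p r ⟩
  ⊨d-post r p e e∈p = ⨆-upper (λ (e : ∃ (exec p)) → ⟦ proj₁ e ⟧* r) (e , e∈p)

  ⊨d-consequence : ∀ {r r′ s′ s} p → r ⪯ r′ → ⊨d⟨ r′ ⟩ p ⟨ s′ ⟩ → s′ ⪯ s → ⊨d⟨ r ⟩ p ⟨ s ⟩
  ⊨d-consequence {r} {r′} {s′} {s} p r⪯r′ h s′⪯s e e∈p =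
    ⪯-trans (⟦ e ⟧* r) (⟦ e ⟧* r′) s (⟦⟧*-mono e r r′ r⪯r′)
      (⪯-trans (⟦ e ⟧* r′) s′ s (h e e∈p) s′⪯s)

  ⊨d-⨾⁺ : ∀ {r t s} p q → ⊨d⟨ r ⟩ p ⟨ t ⟩ → ⊨d⟨ t ⟩ q ⟨ s ⟩ → ⊨d⟨ r ⟩ p ⨾ q ⟨ s ⟩
  ⊨d-⨾⁺ {r} {t} {s} p q hp hq _ (e₁ , e₂ , e₁∈p , e₂∈q , refl) =
    subst (_⪯ s) (sym (⟦⟧*-++ e₁ e₂ r))
      (⪯-trans (⟦ e₂ ⟧* (⟦ e₁ ⟧* r)) (⟦ e₂ ⟧* t) s
        (⟦⟧*-mono e₂ _ t (hp e₁ e₁∈p)) (hq e₂ e₂∈q))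

  -- A single intermediate assertion serves all traces of `p` at once, because each trace of `q`
  -- maps the join of their outcomes below any bound of the individual results.
  ⊨d-⨾⁻ : ∀ {r s} p q → ⊨d⟨ r ⟩ p ⨾ q ⟨ s ⟩ → ⊨d⟨ post p r ⟩ q ⟨ s ⟩
  ⊨d-⨾⁻ {r} {s} p q h e₂ e₂∈q =
    ⟦⟧*-⨆-least e₂ _ s λ (e₁ , e₁∈p) →
      subst (_⪯ s) (⟦⟧*-++ e₁ e₂ r) (h (e₁ ++ e₂) (e₁ , e₂ , e₁∈p , e₂∈q , refl))

  ⊨d-⋆ : ∀ {i} p → ⊨d⟨ i ⟩ p ⟨ i ⟩ → ⊨d⟨ i ⟩ p ⋆ ⟨ i ⟩
  ⊨d-⋆ {i} p h _ (es , es∈p , refl) = iterate es es∈p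
    where
    iterate : ∀ es → All (exec p) es → ⟦ concat es ⟧* i ⪯ i
    iterate []       []           = ⪯-refl i
    iterate (e ∷ es) (e∈p ∷ es∈p) = subst (_⪯ i) (sym (⟦⟧*-++ e (concat es) i))
      (⪯-trans (⟦ concat es ⟧* (⟦ e ⟧* i)) (⟦ concat es ⟧* i) i
        (⟦⟧*-mono (concat es) _ i (h e e∈p)) (iterate es es∈p))

  ⪯post-⋆ : ∀ r p → r ⪯ post (p ⋆) r
  ⪯post-⋆ r p = ⊨d-post r (p ⋆) [] ([] , [] , refl)

  -- One more trace of `p` after an iterated trace is again an iterated trace, and running a trace
  -- from a join is bounded by its runs from the members.
  post-⋆-invariant : ∀ r p → ⊨d⟨ post (p ⋆) r ⟩ p ⟨ post (p ⋆) r ⟩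
  post-⋆-invariant r p e e∈p = ⟦⟧*-⨆-least e _ (post (p ⋆) r) extend
    where
    extend : (e′ : ∃ (exec (p ⋆))) → ⟦ e ⟧* (⟦ proj₁ e′ ⟧* r) ⪯ post (p ⋆) r
    extend (_ , es , es∈p , refl) = subst (_⪯ post (p ⋆) r) (⟦⟧*-++ (concat es) e r)
      (⊨d-post r (p ⋆) (concat es ++ e)
        ( es ++ [ e ] , All.++⁺ es∈p (e∈p ∷ [])
        , trans (cong (concat es ++_) (sym (++-identityʳ e))) (concat-++ es [ e ])))

  -- Composing and decomposing derivations.

  drv-⨾⁺ : ∀ {a b p q} → drv a p → drv b q → drv (a ⨾ b) (p ⨾ q)
  drv-⨾⁺ da db = gmap (_⨾ _) ⨾ˡ da ◅◅ gmap (_ ⨾_) ⨾ʳ db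

  drv-+⁺ : ∀ {a b p q} → drv a p → drv b q → drv (a + b) (p + q)
  drv-+⁺ da db = gmap (_+ _) +ˡ da ◅◅ gmap (_ +_) +ʳ db

  drv-⋆⁺ : ∀ {a p} → drv a p → drv (a ⋆) (p ⋆)
  drv-⋆⁺ = gmap _⋆ ⋆-cong

  drv-cmd⁻ : ∀ {c} p → drv (cmd c) p → p ≡ cmd c
  drv-cmd⁻ (cmd c) ε        = refl
  drv-cmd⁻ (_ ⨾ _) (() ◅ _)
  drv-cmd⁻ (_ + _) (() ◅ _)
  drv-cmd⁻ (_ ⋆)   (() ◅ _)

  -- The endpoint is an arbitrary sketch `x` whose shape is returned as an equation: with `embed p`
  -- in its place, matching on `ε` would have to unify with a stuck term.
  ⇒-⨾⁻ : ∀ {a b x} → Star _⇒_ (a ⨾ b) x →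
         ∃[ a′ ] ∃[ b′ ] x ≡ a′ ⨾ b′ × Star _⇒_ a a′ × Star _⇒_ b b′
  ⇒-⨾⁻ ε            = _ , _ , refl , ε , ε
  ⇒-⨾⁻ (⨾ˡ st ◅ d) with _ , _ , eq , da , db ← ⇒-⨾⁻ d = _ , _ , eq , st ◅ da , db
  ⇒-⨾⁻ (⨾ʳ st ◅ d) with _ , _ , eq , da , db ← ⇒-⨾⁻ d = _ , _ , eq , da , st ◅ db

  ⇒-+⁻ : ∀ {a b x} → Star _⇒_ (a + b) x →
         ∃[ a′ ] ∃[ b′ ] x ≡ a′ + b′ × Star _⇒_ a a′ × Star _⇒_ b b′
  ⇒-+⁻ ε            = _ , _ , refl , ε , ε
  ⇒-+⁻ (+ˡ st ◅ d) with _ , _ , eq , da , db ← ⇒-+⁻ d = _ , _ , eq , st ◅ da , db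
  ⇒-+⁻ (+ʳ st ◅ d) with _ , _ , eq , da , db ← ⇒-+⁻ d = _ , _ , eq , da , st ◅ db

  ⇒-⋆⁻ : ∀ {a x} → Star _⇒_ (a ⋆) x → ∃[ a′ ] x ≡ a′ ⋆ × Star _⇒_ a a′
  ⇒-⋆⁻ ε                = _ , refl , ε
  ⇒-⋆⁻ (⋆-cong st ◅ d) with _ , eq , da ← ⇒-⋆⁻ d = _ , eq , st ◅ da

  drv-⨾⁻ : ∀ {a b} p → drv (a ⨾ b) p → ∃[ q₁ ] ∃[ q₂ ] p ≡ q₁ ⨾ q₂ × drv a q₁ × drv b q₂
  drv-⨾⁻ p         d with ⇒-⨾⁻ d
  -- The equation for `embed p` refutes every other shape of `p`.
  drv-⨾⁻ (q₁ ⨾ q₂) d | _ , _ , refl , da , db = q₁ , q₂ , refl , da , db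

  drv-+⁻ : ∀ {a b} p → drv (a + b) p → ∃[ q₁ ] ∃[ q₂ ] p ≡ q₁ + q₂ × drv a q₁ × drv b q₂
  drv-+⁻ p         d with ⇒-+⁻ d
  drv-+⁻ (q₁ + q₂) d | _ , _ , refl , da , db = q₁ , q₂ , refl , da , db

  drv-⋆⁻ : ∀ {a} p → drv (a ⋆) p → ∃[ q ] p ≡ q ⋆ × drv a q
  drv-⋆⁻ p     d with ⇒-⋆⁻ d
  drv-⋆⁻ (q ⋆) d | _ , refl , da = q , refl , da

  -- Proof rules for triples between selections.

  ⪯ₐ-refl : ∀ R → R ⪯ₐ R
  ⪯ₐ-refl R = All.tabulate λ {r} r∈R → lose r∈R (⪯-refl r)

  ⊨ₐ-consequence : ∀ {R R′ S′ S} sk → R ⪯ₐ R′ → ⊨ₐ⟨ R′ ⟩ sk ⟨ S′ ⟩ → S′ ⪯ₐ S → ⊨ₐ⟨ R ⟩ sk ⟨ S ⟩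
  ⊨ₐ-consequence sk R⪯R′ h S′⪯S = All.map step S′⪯S
    where
    step : ∀ {s} → Any (_⪯ s) _ → Any (λ r → ∃[ p ] drv sk p × ⊨d⟨ r ⟩ p ⟨ s ⟩) _
    step s′⪯s with s′ , s′∈S′ , s′⪯s ← find s′⪯s
              with r′ , r′∈R′ , p , d , hp ← find (All.lookup h s′∈S′) =
      Any.map (λ r⪯r′ → p , d , ⊨d-consequence p r⪯r′ hp s′⪯s) (All.lookup R⪯R′ r′∈R′)

  ⊨ₐ-cmd : ∀ R c → ⊨ₐ⟨ R ⟩ cmd c ⟨ map ⟦ c ⟧↑ R ⟩
  ⊨ₐ-cmd R c = All.map⁺ (All.tabulate λ {r} r∈R →
    lose r∈R (cmd c , ε , λ { _ refl → ⪯-refl (⟦ c ⟧↑ r) }))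

  ⊨ₐ-⨾ : ∀ {R T S} a b → ⊨ₐ⟨ R ⟩ a ⟨ T ⟩ → ⊨ₐ⟨ T ⟩ b ⟨ S ⟩ → ⊨ₐ⟨ R ⟩ a ⨾ b ⟨ S ⟩
  ⊨ₐ-⨾ {R} {T} a b ha = All.map step
    where
    step : ∀ {s} → Any (λ t → ∃[ q ] drv b q × ⊨d⟨ t ⟩ q ⟨ s ⟩) T →
           Any (λ r → ∃[ p ] drv (a ⨾ b) p × ⊨d⟨ r ⟩ p ⟨ s ⟩) R
    step hs with t , t∈T , q , dq , hq ← find hs =
      Any.map (λ (p , dp , hp) → p ⨾ q , drv-⨾⁺ dp dq , ⊨d-⨾⁺ p q hp hq) (All.lookup ha t∈T)

  -- Both branches start from the same singleton `[ r ]`, so the programs chosen for them share the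
  -- precondition `r` and their sum has the postcondition `s₁ ⊔ s₂`.
  ⊨ₐ-+ : ∀ R (a b : AnnSketch NonTerminal) →
         All (λ r → ⊨ₐ⟨ [ r ] ⟩ erase a ⟨ sp [ r ] a ⟩ × ⊨ₐ⟨ [ r ] ⟩ erase b ⟨ sp [ r ] b ⟩) R →
         ⊨ₐ⟨ R ⟩ erase a + erase b ⟨ sp R (a + b) ⟩
  ⊨ₐ-+ R a b h = All.concat⁺ (All.map⁺ (All.tabulate λ {r} r∈R →
    All.cartesianProductWith⁺ (setoid _) (setoid _) _⊔_ (sp [ r ] a) (sp [ r ] b)
      λ {s₁} {s₂} s₁∈ s₂∈ →
        let ha , hb     = All.lookup h r∈R
            p , dp , hp = Any.singleton⁻ (All.lookup ha s₁∈)
            q , dq , hq = Any.singleton⁻ (All.lookup hb s₂∈)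
        in lose r∈R (p + q , drv-+⁺ dp dq , λ where
             e (inj₁ e∈p) → ⪯-trans (⟦ e ⟧* r) s₁ _ (hp e e∈p) (⊔-upperˡ s₁ s₂)
             e (inj₂ e∈q) → ⪯-trans (⟦ e ⟧* r) s₂ _ (hq e e∈q) (⊔-upperʳ s₁ s₂))))

  ⊨ₐ-⋆ : ∀ R I (a : AnnSketch NonTerminal) → SoundInv I (erase a) →
         ⊨ₐ⟨ R ⟩ erase a ⋆ ⟨ sp R (a ⋆[ I ]) ⟩
  ⊨ₐ-⋆ R I a sound = All.tabulate λ {i} i∈sp →
    let i∈I , R⪯i  = ∈-filter⁻ {P = λ i → R ⪯ₐ [ i ]} (λ _ → em) i∈sp
        p , d , hp = Any.singleton⁻ (All.head (All.lookup sound i∈I))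
    in Any.map (λ r⪯i → p ⋆ , drv-⋆⁺ d , ⊨d-consequence (p ⋆) r⪯i (⊨d-⋆ p hp) (⪯-refl i))
         (All.head R⪯i)

  -- Validity of unions of conditions.

  ineq⁺ : ∀ {R S} → R ⪯ₐ S → ⊨ ineq R S
  ineq⁺ h = holds (h ∷ [])

  ineq⁻ : ∀ {R S} → ⊨ ineq R S → R ⪯ₐ S
  ineq⁻ (holds (h ∷ [])) = h

  ∪ᵥ⁺ : ∀ {v w} → ⊨ v → ⊨ w → ⊨ (v ∪ᵥ w)
  ∪ᵥ⁺ (holds hv) (holds hw) = holds (All.++⁺ hv hw)

  ∪ᵥ⁻ : ∀ v w → ⊨ (v ∪ᵥ w) → (⊨ v) × (⊨ w)
  ∪ᵥ⁻ (just v) (just w) (holds h) = holds (All.++⁻ˡ v h) , holds (All.++⁻ʳ v h)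
  ∪ᵥ⁻ nothing  (just _) ()
  ∪ᵥ⁻ nothing  nothing  ()
  ∪ᵥ⁻ (just _) nothing  ()

  ⋃⁺ : ∀ {vs} → All ⊨_ vs → ⊨ ⋃ vs
  ⋃⁺ []       = holds []
  ⋃⁺ (h ∷ hs) = ∪ᵥ⁺ h (⋃⁺ hs)

  ⋃⁻ : ∀ vs → ⊨ ⋃ vs → All ⊨_ vs
  ⋃⁻ []       _ = []
  ⋃⁻ (v ∷ vs) h = let hv , hvs = ∪ᵥ⁻ v (⋃ vs) h in hv ∷ ⋃⁻ vs hvs

  -- Annotated programs as sketches, and soundness of the conditions.

  erase-embedₐ : ∀ (p : AnnProgram) → erase (embedₐ {NonTerminal} p) ≡ embed (erase p)
  erase-embedₐ (cmd c)    = refl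
  erase-embedₐ (p ⨾ q)    = cong₂ _⨾_ (erase-embedₐ p) (erase-embedₐ q)
  erase-embedₐ (p + q)    = cong₂ _+_ (erase-embedₐ p) (erase-embedₐ q)
  erase-embedₐ (p ⋆[ I ]) = cong _⋆ (erase-embedₐ p)

  sp-embedₐ : ∀ R (p : AnnProgram) → sp R (embedₐ {NonTerminal} p) ≡ sp R p
  sp-embedₐ R (cmd c)    = refl
  sp-embedₐ R (p ⨾ q)    = trans (sp-embedₐ _ q) (cong (λ T → sp T q) (sp-embedₐ R p))
  sp-embedₐ R (p + q)    = concatMap-cong
    (λ r → cong₂ (cartesianProductWith _⊔_) (sp-embedₐ [ r ] p) (sp-embedₐ [ r ] q)) R
  sp-embedₐ R (p ⋆[ I ]) = refl

  -- An embedded program contains no non-terminal, so `h` is never consulted.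
  vcWith-embedₐ : ∀ (h : Selection → NonTerminal → Transformer → VC) R p S →
                  vcWith h R (embedₐ p) S ≡ vcProgram R p S
  vcWith-embedₐ h R (cmd c)    S = refl
  vcWith-embedₐ h R (p ⨾ q)    S rewrite sp-embedₐ R p =
    cong₂ _∪ᵥ_ (vcWith-embedₐ h R p (sp R p)) (vcWith-embedₐ h (sp R p) q S)
  vcWith-embedₐ h R (p + q)    S = cong₂ _∪ᵥ_
    (cong (λ T → ineq T S) (sp-embedₐ R (p + q)))
    (cong ⋃ (map-cong (λ r → cong₂ _∪ᵥ_ (branch r p) (branch r q)) R))
    where
    branch : ∀ r p → vcWith h [ r ] (embedₐ p) (sp [ r ] (embedₐ {NonTerminal} p))
                     ≡ vcProgram [ r ] p (sp [ r ] p)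
    branch r p rewrite sp-embedₐ [ r ] p = vcWith-embedₐ h [ r ] p (sp [ r ] p)
  vcWith-embedₐ h R (p ⋆[ I ]) S =
    cong (λ vs → ineq (sp R (p ⋆[ I ])) S ∪ᵥ ⋃ vs)
      (map-cong (λ i → vcWith-embedₐ h [ i ] p [ i ]) I)

  -- Abstracting over `h` lets one induction serve programs first and then sketches, whose oracle
  -- conditions are sound because those of programs are. At a loop, the conditions on the body make
  -- `I` sound by induction.
  vcWith-sound : (h : Selection → NonTerminal → Transformer → VC) →
                 (∀ R N Γ → ⊨ h R N Γ → ⊨ₐ⟨ R ⟩ nt N ⟨ apply Γ R ⟩) →
                 ∀ R sk S → ⊨ vcWith h R sk S → ⊨ₐ⟨ R ⟩ erase sk ⟨ S ⟩
  vcWith-sound h h-sound R (cmd c) S v =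
    ⊨ₐ-consequence (cmd c) (⪯ₐ-refl R) (⊨ₐ-cmd R c) (ineq⁻ v)
  vcWith-sound h h-sound R (a ⨾ b) S v =
    let va , vb = ∪ᵥ⁻ (vcWith h R a (sp R a)) _ v in
    ⊨ₐ-⨾ (erase a) (erase b)
      (vcWith-sound h h-sound R a _ va) (vcWith-sound h h-sound (sp R a) b S vb)
  vcWith-sound h h-sound R (a + b) S v =
    let v₁ , v₂ = ∪ᵥ⁻ (ineq (sp R (a + b)) S) _ v in
    ⊨ₐ-consequence (erase a + erase b) (⪯ₐ-refl R)
      (⊨ₐ-+ R a b (All.map
        (λ {r} w → let wa , wb = ∪ᵥ⁻ (vcWith h [ r ] a (sp [ r ] a)) _ w in
          vcWith-sound h h-sound [ r ] a _ wa , vcWith-sound h h-sound [ r ] b _ wb)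
        (All.map⁻ (⋃⁻ _ v₂))))
      (ineq⁻ v₁)
  vcWith-sound h h-sound R (a ⋆[ I ]) S v =
    let v₁ , v₂ = ∪ᵥ⁻ (ineq (sp R (a ⋆[ I ])) S) _ v in
    ⊨ₐ-consequence (erase a ⋆) (⪯ₐ-refl R)
      (⊨ₐ-⋆ R I a (All.map (λ {i} w → vcWith-sound h h-sound [ i ] a [ i ] w) (All.map⁻ (⋃⁻ _ v₂))))
      (ineq⁻ v₁)
  vcWith-sound h h-sound R (nt N Γ) S v =
    let v₁ , v₂ = ∪ᵥ⁻ (ineq (apply Γ R) S) _ v in
    ⊨ₐ-consequence (nt N) (⪯ₐ-refl R) (h-sound R N Γ v₂) (ineq⁻ v₁)

  vcProgram-sound : ∀ R p S → ⊨ vcProgram R p S → ⊨ₐ⟨ R ⟩ embed (erase p) ⟨ S ⟩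
  vcProgram-sound R p S v = subst (λ sk → ⊨ₐ⟨ R ⟩ sk ⟨ S ⟩) (erase-embedₐ p)
    -- The everywhere undefined `h` is vacuously sound, since `nothing` is never valid.
    (vcWith-sound (λ _ _ _ → nothing) (λ _ _ _ ()) R (embedₐ p) S
      (subst ⊨_ (sym (vcWith-embedₐ _ R p S)) v))

  -- A derivation starting at `embed p` continues the one from `nt N` to it.
  ⊨ₐ-nt : ∀ {R S N} p → drv (nt N) p → ⊨ₐ⟨ R ⟩ embed p ⟨ S ⟩ → ⊨ₐ⟨ R ⟩ nt N ⟨ S ⟩
  ⊨ₐ-nt p d = All.map (Any.map λ (q , dq , hq) → q , d ◅◅ dq , hq)

  -- Well-founded descent; excluded middle decides whether a smaller instance exists.
  ∃-least : (P : ℕ → Set₁) → ∀ n → P n → ∃ (Least P)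
  ∃-least P = <-rec _ λ n rec Pn → descend n rec Pn
    where
    descend : ∀ n → (∀ {k} → k < n → P k → ∃ (Least P)) → P n → ∃ (Least P)
    descend n rec Pn with em {∃[ k ] k < n × P k}
    ... | yes (k , k<n , Pk) = rec k<n Pk
    ... | no  ¬smaller       = n , Pn , λ k k<n Pk → ¬smaller (k , k<n , Pk)

  -- The oracle, and completeness under sound and complete annotations.

  module _ (𝕆 : Oracle) where

    open Oracle 𝕆

    first-enum : ∀ N j → All (λ p → ∃[ i ] enum N i ≡ just p) (first N j)
    first-enum N j = All.mapMaybe⁺ (All.map⁺ (All.applyUpTo⁺₂ id j returns))
      where
      returns : ∀ i → Maybe.All (λ p → ∃[ i ] enum N i ≡ just p) (enum N i)
      returns i with enum N i in eq
      ... | just _  = Maybe.just (i , eq)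
      ... | nothing = Maybe.nothing

    enum-first : ∀ N {i j p} → enum N i ≡ just p → i < j → p ∈ₚ first N j
    enum-first N {i} {j} {p} eq i<j = Any.mapMaybe⁺ (enum N) (upTo j)
      (Any.map⁺ (Any.applyUpTo⁺ id (subst (MaybeAny.Any (p ≡_)) (sym eq) (MaybeAny.just refl)) i<j))

    -- Each returned program `p` attains `sp R p` by soundness for programs, and at the chosen `j`
    -- the union of these selections is below `apply Γ R`.
    vcOracle-sound : ∀ R N Γ → ⊨ vcOracle 𝕆 R N Γ → ⊨ₐ⟨ R ⟩ nt N ⟨ apply Γ R ⟩
    vcOracle-sound R N Γ v with em {∃ (Least (Covers 𝕆 R N Γ))}
    vcOracle-sound R N Γ v | yes (j , covers , _) =
      ⊨ₐ-consequence (nt N) (⪯ₐ-refl R)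
        (All.concat⁺ (All.map⁺ (All.tabulate λ {p} p∈first →
          let i , eq = All.lookup (first-enum N j) p∈first in
          ⊨ₐ-nt (erase p) (derivable N i p eq)
            (vcProgram-sound R p (sp R p) (All.lookup (All.map⁻ (⋃⁻ _ v)) p∈first)))))
        covers
    vcOracle-sound R N Γ () | no _

    -- Soundness of the annotations makes `sp` attainable. This supplies the intermediate triples
    -- that the conditions for sequences and choices ask for.
    ⊨ₐ-sp : ∀ R {sk} → SoundComplete 𝕆 sk → ⊨ₐ⟨ R ⟩ erase sk ⟨ sp R sk ⟩
    ⊨ₐ-sp R {cmd c}     cmd                 = ⊨ₐ-cmd R c
    ⊨ₐ-sp R {a ⨾ b}     (sa ⨾ sb)           =
      ⊨ₐ-⨾ (erase a) (erase b) (⊨ₐ-sp R sa) (⊨ₐ-sp (sp R a) sb)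
    ⊨ₐ-sp R {a + b}     (sa + sb)           =
      ⊨ₐ-+ R a b (All.universal (λ r → ⊨ₐ-sp [ r ] sa , ⊨ₐ-sp [ r ] sb) R)
    ⊨ₐ-sp R {a ⋆[ I ]}  (_ ⋆[ sound , _ ])  = ⊨ₐ-⋆ R I a sound
    ⊨ₐ-sp R {nt N Γ}    (nt (sound , _) _)  = sound R

    -- Completeness of the annotations makes `sp` a lower bound of all valid postconditions. The
    -- proof is mutual with the splitting of sequences, which applies leastness to the first
    -- component.
    sp-least : ∀ R S {sk} → SoundComplete 𝕆 sk → ⊨ₐ⟨ R ⟩ erase sk ⟨ S ⟩ → sp R sk ⪯ₐ S
    ⊨ₐ-⨾⁻ : ∀ R S {a} b → SoundComplete 𝕆 a → ⊨ₐ⟨ R ⟩ erase a ⨾ b ⟨ S ⟩ → ⊨ₐ⟨ sp R a ⟩ b ⟨ S ⟩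

    ⊨ₐ-⨾⁻ R S {a} b sa = All.map λ {s} hs → step s (find hs)
      where
      step : ∀ s → ∃[ r ] r ∈ₚ R × (∃[ p ] drv (erase a ⨾ b) p × ⊨d⟨ r ⟩ p ⟨ s ⟩) →
             Any (λ t → ∃[ q ] drv b q × ⊨d⟨ t ⟩ q ⟨ s ⟩) (sp R a)
      -- The singleton `[ post q₁ r ]` is a valid postcondition of `a`, so some element of `sp R a`
      -- lies below it, and `q₂` reaches `s` from there.
      step s (r , r∈R , p , d , hp) with q₁ , q₂ , refl , d₁ , d₂ ← drv-⨾⁻ p d =
        Any.map (λ t⪯post → q₂ , d₂ , ⊨d-consequence q₂ t⪯post (⊨d-⨾⁻ q₁ q₂ hp) (⪯-refl s))
          (All.head (sp-least R [ post q₁ r ] sa (lose r∈R (q₁ , d₁ , ⊨d-post r q₁) ∷ [])))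

    sp-least R S {cmd c} cmd h = All.map step h
      where
      step : ∀ {s} → Any (λ r → ∃[ p ] drv (cmd c) p × ⊨d⟨ r ⟩ p ⟨ s ⟩) R →
             Any (_⪯ s) (map ⟦ c ⟧↑ R)
      step = Any.map⁺ ∘ Any.map λ (p , d , hp) → weaken p d hp
        where
        weaken : ∀ {r s} p → drv (cmd c) p → ⊨d⟨ r ⟩ p ⟨ s ⟩ → ⟦ c ⟧↑ r ⪯ s
        weaken p d hp with refl ← drv-cmd⁻ p d = hp [ c ] refl
    sp-least R S {a ⨾ b} (sa ⨾ sb) h = sp-least (sp R a) S sb (⊨ₐ-⨾⁻ R S (erase b) sa h)
    sp-least R S {a + b} (sa + sb) h =
      All.map (λ {s} hs → Any.concatMap⁺ _ (Any.map (step s) hs)) h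
      where
      step : ∀ s {r} → (∃[ p ] drv (erase a + erase b) p × ⊨d⟨ r ⟩ p ⟨ s ⟩) →
             Any (_⪯ s) (cartesianProductWith _⊔_ (sp [ r ] a) (sp [ r ] b))
      -- Traces of either branch are traces of the sum, so `s` bounds an element of each branch's
      -- `sp`, hence their join.
      step s {r} (p , d , hp) with q₁ , q₂ , refl , d₁ , d₂ ← drv-+⁻ p d =
        Any.cartesianProductWith⁺ _⊔_ (λ {s₁} {s₂} → ⊔-least s₁ s₂ s)
          (All.head (sp-least [ r ] [ s ] sa (here (q₁ , d₁ , λ e e∈ → hp e (inj₁ e∈)) ∷ [])))
          (All.head (sp-least [ r ] [ s ] sb (here (q₂ , d₂ , λ e e∈ → hp e (inj₂ e∈)) ∷ [])))
    sp-least R S {a ⋆[ I ]} (sa ⋆[ _ , complete ]) h = All.map (λ {s} hs → step s (find hs)) h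
      where
      step : ∀ s → ∃[ r ] r ∈ₚ R × (∃[ p ] drv (erase a ⋆) p × ⊨d⟨ r ⟩ p ⟨ s ⟩) →
             Any (_⪯ s) (sp R (a ⋆[ I ]))
      -- Completeness puts the invariant `post (q ⋆) r` into `I` up to `_≃_`, as `i`. It lies above
      -- `r`, so the filter keeps it, and below `s`, since `s` bounds all outcomes.
      step s (r , r∈R , p , d , hp) with q , refl , dq ← drv-⋆⁻ p d
        with i , i∈I , j⪯i , i⪯j ←
          find (complete (post (q ⋆) r) (here (q , dq , post-⋆-invariant r q) ∷ [])) =
        lose
          (∈-filter⁺ {P = λ i → R ⪯ₐ [ i ]} (λ _ → em) i∈I
            (lose r∈R (⪯-trans r _ i (⪯post-⋆ r q) j⪯i) ∷ []))
          (⪯-trans i (post (q ⋆) r) s i⪯j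
            (⨆-least _ s λ (e , e∈q⋆) → hp e e∈q⋆))
    sp-least R S {nt N Γ} (nt (_ , complete) _) h = complete R S h

    -- Termination of the oracle search.

    module _ (R : Selection) (N : NonTerminal)
             (annotated : ∀ i p → enum N i ≡ just p → SoundComplete 𝕆 (embedₐ p)) where

      -- A witness program for `s` is eventually returned, and leastness puts an element of its `sp`
      -- below `s`. The claim covers all later `k` so that bounds for several `s` can be combined by
      -- a maximum.
      reached : ∀ s → Any (λ r → ∃[ p ] drv (nt N) p × ⊨d⟨ r ⟩ p ⟨ s ⟩) R →
                ∃[ j ] (∀ {k} → j ≤ k → Any (_⪯ s) (concatMap (sp R) (first N k)))
      reached s hs with r , r∈R , p , d , hp ← find hs
        with i , p′ , eq , refl ← returned N p d =
        -- `first N k` lists the indices strictly below `k`, hence the successor.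
        suc i , λ i<k → Any.concatMap⁺ (sp R) (lose (enum-first N eq i<k)
          (subst (Any (_⪯ s)) (sp-embedₐ R p′)
            (All.head (sp-least R [ s ] (annotated i p′ eq)
              (lose r∈R (p , subst (λ sk → Star _⇒_ sk (embed p)) (sym (erase-embedₐ p′)) ε , hp)
                ∷ [])))))

      all-reached : ∀ S → ⊨ₐ⟨ R ⟩ nt N ⟨ S ⟩ →
                    ∃[ j ] (∀ {k} → j ≤ k → concatMap (sp R) (first N k) ⪯ₐ S)
      all-reached []      []       = 0 , λ _ → []
      all-reached (s ∷ S) (h ∷ hs) =
        let j₁ , c₁ = reached s h
            j₂ , c₂ = all-reached S hs
        in j₁ ⊔ℕ j₂ , λ j≤k →
             c₁ (≤-trans (m≤m⊔n j₁ j₂) j≤k) ∷ c₂ (≤-trans (m≤n⊔m j₁ j₂) j≤k)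

    -- Leastness of `sp` yields the inequalities against `S`; attainability yields the triples
    -- required of the subterms.
    vc-complete : ∀ R S {sk} → SoundComplete 𝕆 sk → ⊨ₐ⟨ R ⟩ erase sk ⟨ S ⟩ → ⊨ vc 𝕆 R sk S
    vc-complete R S cmd h = ineq⁺ (sp-least R S cmd h)
    vc-complete R S {a ⨾ b} (sa ⨾ sb) h = ∪ᵥ⁺
      (vc-complete R (sp R a) sa (⊨ₐ-sp R sa))
      (vc-complete (sp R a) S sb (⊨ₐ-⨾⁻ R S (erase b) sa h))
    vc-complete R S {a + b} s@(sa + sb) h = ∪ᵥ⁺ (ineq⁺ (sp-least R S s h))
      (⋃⁺ (All.map⁺ (All.universal (λ r → ∪ᵥ⁺
        (vc-complete [ r ] _ sa (⊨ₐ-sp [ r ] sa))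
        (vc-complete [ r ] _ sb (⊨ₐ-sp [ r ] sb))) R)))
    vc-complete R S s@(sa ⋆[ sound , _ ]) h = ∪ᵥ⁺ (ineq⁺ (sp-least R S s h))
      -- Soundness of `I` is exactly validity of the body triples.
      (⋃⁺ (All.map⁺ (All.map (λ {i} → vc-complete [ i ] [ i ] sa) sound)))
    vc-complete R S {nt N Γ} s@(nt (sound , _) annotated) h =
      ∪ᵥ⁺ (ineq⁺ (sp-least R S s h)) oracle
      where
      oracle : ⊨ vcOracle 𝕆 R N Γ
      oracle with em {∃ (Least (Covers 𝕆 R N Γ))}
      ... | yes (j , _) = ⋃⁺ (All.map⁺ (All.map (λ {p} (i , eq) →
              subst ⊨_ (trans (vcWith-embedₐ (vcOracle 𝕆) R p _) (cong (vcProgram R p) (sp-embedₐ R p)))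
                (vc-complete R _ (annotated i p eq) (⊨ₐ-sp R (annotated i p eq))))
              (first-enum N j)))
      -- Soundness of `Γ` witnesses each of the finitely many elements of `apply Γ R`, so some `j`
      -- covers them all and a least one exists.
      ... | no ¬least =
        let j , covers = all-reached R N annotated (apply Γ R) (sound R) in
        ⊥-elim (¬least (∃-least (Covers 𝕆 R N Γ) j (covers ≤-refl)))

theorem5p1 : (em : ExcludedMiddle (lsuc 0ℓ)) (States COM : Set)
    (⟦_⟧ : COM → States → Predicate States) (G : Grammar COM) →
    let open Framework em ⟦_⟧ G
        open Grammar G using (NonTerminal) in
    (𝕆 : Oracle) (R S : Selection) (sk : AnnSketch NonTerminal) →
    ((⊨ vc 𝕆 R sk S) → ⊨ₐ⟨ R ⟩ erase sk ⟨ S ⟩) ×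
    (SoundComplete 𝕆 sk → ⊨ₐ⟨ R ⟩ erase sk ⟨ S ⟩ → ⊨ vc 𝕆 R sk S)
theorem5p1 em States COM ⟦_⟧ G 𝕆 R S sk =
  vcWith-sound em ⟦_⟧ G (vcOracle 𝕆) (vcOracle-sound em ⟦_⟧ G 𝕆) R sk S ,
  vc-complete em ⟦_⟧ G 𝕆 R S
  where open Framework em ⟦_⟧ G
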